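{- For all fixed positive integers $n>m$, there are algorithms which, given a finite graph $H$ (respectively a finite bipartite graph $H$), decide in time polynomial in $|H|$ whether $H$ is $(n,m)$-Helly (respectively whether $H$ is bipartite $(n,m)$-Helly).
   Context: Graphs are nonempty, connected and simple, endowed with the path metric, and presented by their adjacency matrix; $|H|$ is the number of vertices. A graph $H$ is $(n,m)$-Helly if for every collection of $n$ (not necessarily distinct) closed balls $B_1,\dots,B_n$ in $H$ of radius $\ge 1$: whenever every subcollection of $m$ of them has nonempty intersection, then $\bigcap_{i=1}^n B_i\neq\varnothing$. A bipartite graph $H$ is bipartite $(n,m)$-Helly if for all (not necessarily distinct) balls $B_1,\dots,B_n$ in $H$ (closed balls of non-negative integer radius) and each partite class $H_1$ of $H$: if any $m$ of the sets $B_1\cap H_1,\dots,B_n\cap H_1$ have nonempty intersection, then $\bigcap_{i=1}^n (B_i\cap H_1)\neq\varnothing$. -}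

module Defs where

open import Data.Bool using (Bool; true; false; if_then_else_)
open import Data.Fin using (Fin)
open import Data.Fin.Subset using (Subset; ∣_∣) renaming (_∈_ to _∈ₛ_)
open import Data.List using (List; []; _∷_; tabulate)
open import Data.Nat using (ℕ; suc; _+_; _*_; _^_; _≤_; NonZero; _≡ᵇ_)
open import Data.Product using (Σ-syntax; ∃-syntax; _×_)
open import Level using (0ℓ)
open import Relation.Binary.PropositionalEquality using (_≡_; _≢_)
open import Relation.Nullary.Reflects using (Reflects)
open import Relation.Unary using (Pred; _∈_; _∩_; Satisfiable)

module _ {k : ℕ} (adj : Fin k → Fin k → Bool) where

  data Walk : Fin k → Fin k → ℕ → Set where
    stay : ∀ {u} → Walk u u 0
    step : ∀ {u v w ℓ} → adj u v ≡ true → Walk v w ℓ → Walk u w (suc ℓ)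

record Graph : Set where
  field
    order       : ℕ
    nonempty    : NonZero order
    adj         : Fin order → Fin order → Bool
    symmetric   : ∀ u v → adj u v ≡ adj v u
    irreflexive : ∀ v → adj v v ≡ false
    connected   : ∀ u v → ∃[ ℓ ] Walk adj u v ℓ

  Vertex : Set
  Vertex = Fin order

  -- The graph of the path metric: Dist u v d says that d(u,v) = d.
  Dist : Vertex → Vertex → ℕ → Set
  Dist u v d = Walk adj u v d × (∀ ℓ → Walk adj u v ℓ → d ≤ ℓ)

  Ball : Vertex → ℕ → Pred Vertex 0ℓ
  Ball c r v = ∃[ d ] (Dist c v d × d ≤ r)

record BipartiteGraph : Set where
  field
    graph : Graph
  open Graph graph public
  -- The two partite classes are the fibres of `side`; by connectedness they
  -- are determined, up to order, by the graph.
  field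
    side   : Vertex → Bool
    proper : ∀ u v → adj u v ≡ true → side u ≢ side v

  PartiteClass : Bool → Pred Vertex 0ℓ
  PartiteClass b v = side v ≡ b

-- Subcollections are subsets of the index set, so repeated members of the
-- family count with multiplicity.
HellyFamily : ∀ {n} {V : Set} → ℕ → (Fin n → Pred V 0ℓ) → Set
HellyFamily {n} m F =
  (∀ (S : Subset n) → ∣ S ∣ ≡ m → Satisfiable (λ v → ∀ i → i ∈ₛ S → v ∈ F i)) →
  Satisfiable (λ v → ∀ i → v ∈ F i)

Helly : ℕ → ℕ → Graph → Set
Helly n m H =
  ∀ (c : Fin n → Vertex) (r : Fin n → ℕ) → (∀ i → 1 ≤ r i) →
  HellyFamily m (λ i → Ball (c i) (r i))
  where open Graph H

BipartiteHelly : ℕ → ℕ → BipartiteGraph → Set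
BipartiteHelly n m H =
  ∀ (c : Fin n → Vertex) (r : Fin n → ℕ) (b : Bool) →
  HellyFamily m (λ i → Ball (c i) (r i) ∩ PartiteClass b)
  where open BipartiteGraph H

-- The WHILE language over binary trees of N. D. Jones
-- (Computability and Complexity from a Programming Perspective, MIT Press,
-- 1997), with its unit-cost time measure.  Values are only built and taken
-- apart one node at a time and there is no tree-equality primitive, so trees
-- can be shared as pointers and polynomial time in this model coincides with
-- polynomial time on Turing machines.

data Tree : Set where
  nil : Tree
  _∙_ : Tree → Tree → Tree

infixr 5 _∙_

head tail : Tree → Tree
head nil     = nil
head (s ∙ _) = s
tail nil     = nil
tail (_ ∙ t) = t

truth : Tree → Bool
truth nil     = false
truth (_ ∙ _) = true

Var : Set
Var = ℕ

data Expr : Set where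
  var     : Var → Expr
  const   : Tree → Expr
  cons    : Expr → Expr → Expr
  hd tl   : Expr → Expr

infix  7 _≔_
infixr 6 _⨾_

data Cmd : Set where
  _≔_   : Var → Expr → Cmd
  _⨾_   : Cmd → Cmd → Cmd
  cond  : Expr → Cmd → Cmd → Cmd
  while : Expr → Cmd → Cmd

Store : Set
Store = Var → Tree

_[_↦_] : Store → Var → Tree → Store
(σ [ x ↦ t ]) y = if x ≡ᵇ y then t else σ y

eval : Expr → Store → Tree
eval (var x)    σ = σ x
eval (const t)  σ = t
eval (cons e f) σ = eval e σ ∙ eval f σ
eval (hd e)     σ = head (eval e σ)
eval (tl e)     σ = tail (eval e σ)

cost : Expr → ℕ
cost (var _)    = 1
cost (const _)  = 1
cost (cons e f) = 1 + cost e + cost f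
cost (hd e)     = 1 + cost e
cost (tl e)     = 1 + cost e

-- Exec C σ t σ′: started in store σ, C halts after time t in store σ′.
data Exec : Cmd → Store → ℕ → Store → Set where
  assign : ∀ {x e σ} →
    Exec (x ≔ e) σ (1 + cost e) (σ [ x ↦ eval e σ ])
  seq : ∀ {C D σ σ′ σ″ s t} →
    Exec C σ s σ′ → Exec D σ′ t σ″ → Exec (C ⨾ D) σ (1 + s + t) σ″
  cond-true : ∀ {e C D σ σ′ t} → truth (eval e σ) ≡ true →
    Exec C σ t σ′ → Exec (cond e C D) σ (1 + cost e + t) σ′
  cond-false : ∀ {e C D σ σ′ t} → truth (eval e σ) ≡ false →
    Exec D σ t σ′ → Exec (cond e C D) σ (1 + cost e + t) σ′
  while-true : ∀ {e C σ σ′ σ″ s t} → truth (eval e σ) ≡ true →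
    Exec C σ s σ′ → Exec (while e C) σ′ t σ″ →
    Exec (while e C) σ (1 + cost e + s + t) σ″
  while-false : ∀ {e C σ} → truth (eval e σ) ≡ false →
    Exec (while e C) σ (1 + cost e) σ

record Program : Set where
  constructor read_body_write_
  field
    input  : Var
    code   : Cmd
    output : Var

Computes : Program → Tree → Tree → ℕ → Set
Computes p x y t =
  ∃[ σ ] (Exec code ((λ _ → nil) [ input ↦ x ]) t σ × σ output ≡ y)
  where open Program p

encodeBool : Bool → Tree
encodeBool false = nil
encodeBool true  = nil ∙ nil

encodeList : List Tree → Tree
encodeList []       = nil
encodeList (t ∷ ts) = t ∙ encodeList ts

-- The adjacency matrix, as the list of its rows.
encodeGraph : Graph → Tree
encodeGraph H =
  encodeList (tabulate λ u → encodeList (tabulate λ v → encodeBool (adj u v)))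
  where open Graph H

-- Polynomial-time decision of a property of graphs from a class A; the
-- algorithm sees only the adjacency matrix of the underlying graph, and its
-- behaviour on other inputs is unconstrained.  As orders are positive, every
-- polynomial in |H| is dominated by one of the form c * |H| ^ d.

PolyTimeDecidable : {A : Set} → (A → Graph) → (A → Set) → Set
PolyTimeDecidable {A} underlying P =
  Σ[ p ∈ Program ] ∃[ c ] ∃[ d ] (∀ (H : A) →
    ∃[ b ] ∃[ t ]
      ( Computes p (encodeGraph (underlying H)) (encodeBool b) t
      × t ≤ c * Graph.order (underlying H) ^ d
      × Reflects (P H) b ))

{-# OPTIONS --safe #-}
module Submission where

-- A ball has the same vertices as the ball of radius min(r, |H|) about the same
-- centre, so there are at most |H|(|H| + 1) balls, and all n-tuples of them can
-- be tested by brute force, n and m being fixed.  Balls are rows of the Boolean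
-- powers of I ∨ A, with A the adjacency matrix.  The partite class of w is row
-- w of the |H|-th power of I ∨ A², so that quantifying over classes amounts to
-- quantifying over w; a class that is empty satisfies the Helly property
-- vacuously because m ≥ 1.

open import Data.Bool using (Bool; true; false; if_then_else_; not; _∧_; _∨_)
open import Data.Bool.ListAction using (all; any)
open import Data.Bool.Properties using (∧-identityʳ; ∧-assoc; ∨-identityʳ; ∨-assoc)
open import Data.Fin using (Fin; zero; suc; toℕ)
open import Data.Fin.Properties using (toℕ<n; toℕ-injective; any?)
open import Data.Fin.Subset using (Subset; ∣_∣; ⊤; ⊥; _⊆_; _⊂_) renaming (_∈_ to _∈ₛ_)
open import Data.Fin.Subset.Properties using (_∈?_; p⊂q⇒∣p∣<∣q∣; ∣p∣≤n; ∈⊤; ∣⊥∣≡0)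
open import Data.List using (List; []; _∷_; map; foldl; length; replicate; reverse; downFrom; upTo;
  applyUpTo; allFin; tabulate)
open import Data.List.Properties
open import Data.List.Membership.Propositional using (_∈_)
open import Data.List.Membership.Propositional.Properties using (∈-allFin)
open import Data.List.Relation.Unary.Any using (here; there)
open import Data.List.Relation.Unary.Any.Properties using (reverse⁺)
open import Data.Nat using (ℕ; zero; suc; _+_; _*_; _^_; _≤_; _<_; z≤n; s≤s; s≤s⁻¹;
  _≤′_; ≤′-refl; ≤′-step; _⊓_; _≡ᵇ_; _<ᵇ_; NonZero; >-nonZero⁻¹)
open import Data.Nat.Properties
open import Data.Product using (Σ; _×_; _,_; proj₁; proj₂; ∃-syntax)
open import Data.Sum using (_⊎_; inj₁; inj₂)
open import Data.Vec as Vec using (Vec; []; _∷_; lookup; here; there) renaming (head to headᵛ; tail to tailᵛ)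
open import Data.Vec.Properties using (lookup⇒[]=; []=⇒lookup; lookup∘tabulate)
open import Function using (id; _∘_; case_of_)
open import Level using (0ℓ)
open import Relation.Binary.PropositionalEquality
open import Relation.Nullary using (yes; no; contradiction; ¬?; _×-dec_; decidable-stable)
open import Relation.Nullary.Reflects using (Reflects; ofʸ; ofⁿ; fromEquivalence;
  ¬-reflects; _×-reflects_; _⊎-reflects_; _→-reflects_)
open import Relation.Unary using (Pred; Satisfiable)
open import Defs

-- The obstacle is the machine model: the algorithm has to be an explicit WHILE program with a
-- proved running time. Programs are therefore assembled from `Term`s, each of which carries its
-- specification and a polynomial bound in a size `N` over an index type `D`. A loop enlarges `D` by
-- its current element and its accumulator but leaves the size at |H|, so the bounds of nested loops
-- multiply. The parameters `n` and `m` only steer the construction of the program: tuples become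
-- nested loops, subsets become cases written out in the code. Between programs and graphs stands
-- the Boolean function `hellyCheck`: terms compute it, and `Reflects` lemmas identify it with the
-- Helly property. The cap at |H| rests on a growth argument: for a reflexive matrix, the set of
-- vertices that reach a given vertex in j steps grows strictly until it is constant. This covers I
-- ∨ A and I ∨ A² alike. The second is needed because the program is not given `side` and must
-- recover the classes from adjacency.

-- Programs acting on a single variable

app : Expr → Tree → Tree
app e x = eval e (λ _ → x)

-- Renaming every variable to 0 makes each expression a function of one tree, so that `eval-single`
-- holds without a condition on the variables that occur.
single : Expr → Expr
single (var _)    = var 0
single (const t)  = const t
single (cons e f) = cons (single e) (single f)
single (hd e)     = hd (single e)
single (tl e)     = tl (single e)

eval-single : ∀ e σ → eval (single e) σ ≡ app e (σ 0)
eval-single (var _)    σ = refl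
eval-single (const _)  σ = refl
eval-single (cons e f) σ = cong₂ _∙_ (eval-single e σ) (eval-single f σ)
eval-single (hd e)     σ = cong head (eval-single e σ)
eval-single (tl e)     σ = cong tail (eval-single e σ)

pattern X = var 0

-- A total-correctness triple for variable 0. The time is an upper bound, so that branches and
-- iterations of different cost can share one figure.
Runs : Cmd → Tree → ℕ → Tree → Set
Runs C x t y = ∀ σ → σ 0 ≡ x →
  ∃[ σ′ ] ∃[ t′ ] (Exec C σ t′ σ′ × t′ ≤ t × σ′ 0 ≡ y)

runs-≤ : ∀ {C x s t y} → s ≤ t → Runs C x s y → Runs C x t y
runs-≤ s≤t r σ eq with r σ eq
... | σ′ , t′ , e , le , eq′ = σ′ , t′ , e , ≤-trans le s≤t , eq′

set : Expr → Cmd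
set e = 0 ≔ single e

runs-set : ∀ e {x} → Runs (set e) x (1 + cost (single e)) (app e x)
runs-set e σ refl = _ , _ , assign , ≤-refl , eval-single e σ

runs-seq : ∀ {C D x y z s t} → Runs C x s y → Runs D y t z → Runs (C ⨾ D) x (1 + s + t) z
runs-seq r r′ σ eq with r σ eq
... | σ₁ , t₁ , e₁ , le₁ , eq₁ with r′ σ₁ eq₁
... | σ₂ , t₂ , e₂ , le₂ , eq₂ = σ₂ , _ , seq e₁ e₂ , s≤s (+-mono-≤ le₁ le₂) , eq₂

truth-single : ∀ e σ {b} → truth (app e (σ 0)) ≡ b → truth (eval (single e) σ) ≡ b
truth-single e σ eq = trans (cong truth (eval-single e σ)) eq

runs-cond : ∀ e {C D x y t} b → truth (app e x) ≡ b → Runs (if b then C else D) x t y →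
  Runs (cond (single e) C D) x (1 + cost (single e) + t) y
runs-cond e true test r σ refl with r σ refl
... | σ₁ , t₁ , e₁ , le₁ , eq₁ =
  σ₁ , _ , cond-true (truth-single e σ test) e₁ , +-monoʳ-≤ (1 + cost (single e)) le₁ , eq₁
runs-cond e false test r σ refl with r σ refl
... | σ₁ , t₁ , e₁ , le₁ , eq₁ =
  σ₁ , _ , cond-false (truth-single e σ test) e₁ , +-monoʳ-≤ (1 + cost (single e)) le₁ , eq₁

runs-while-false : ∀ e {C x} → truth (app e x) ≡ false →
  Runs (while (single e) C) x (1 + cost (single e)) x
runs-while-false e test σ refl = σ , _ , while-false (truth-single e σ test) , ≤-refl , refl

runs-while-true : ∀ e {C x y z s t} → truth (app e x) ≡ true → Runs C x s y →
  Runs (while (single e) C) y t z →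
  Runs (while (single e) C) x (1 + cost (single e) + s + t) z
runs-while-true e test r r′ σ refl with r σ refl
... | σ₁ , t₁ , e₁ , le₁ , eq₁ with r′ σ₁ eq₁
... | σ₂ , t₂ , e₂ , le₂ , eq₂ =
  σ₂ , _ , while-true (truth-single e σ test) e₁ e₂ ,
  +-mono-≤ (+-monoʳ-≤ (1 + cost (single e)) le₁) le₂ , eq₂

-- Polynomial bounds

-- The base `suc (N δ)` is positive even at size 0, so its powers grow with the exponent, on which
-- `_+ₚ_` relies. One coefficient and one degree serve all of `D`, which lets a bound survive
-- `reindex`.
record Poly {D : Set} (N T : D → ℕ) : Set where
  constructor poly
  field
    coeff deg : ℕ
    bound     : ∀ δ → T δ ≤ coeff * suc (N δ) ^ deg

module _ {D : Set} {N : D → ℕ} where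

  const-poly : ∀ k → Poly N (λ _ → k)
  const-poly k = poly k 0 λ _ → ≤-reflexive (sym (*-identityʳ k))

  set-poly : ∀ e → Poly N (λ _ → 1 + cost (single e))
  set-poly e = const-poly _

  size-poly : Poly N N
  size-poly = poly 1 1 λ δ → ≤-trans (n≤1+n _)
    (≤-reflexive (sym (trans (*-identityˡ _) (*-identityʳ _))))

  poly-≤ : ∀ {S T : D → ℕ} → (∀ δ → S δ ≤ T δ) → Poly N T → Poly N S
  poly-≤ le (poly c d b) = poly c d λ δ → ≤-trans (le δ) (b δ)

  infixl 6 _+ₚ_
  infixl 7 _*ₚ_

  _+ₚ_ : ∀ {S T : D → ℕ} → Poly N S → Poly N T → Poly N (λ δ → S δ + T δ)
  _+ₚ_ {S} {T} (poly c d p) (poly c′ d′ q) = poly (c + c′) (d + d′) λ δ →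
    let M = suc (N δ) in begin
    S δ + T δ                               ≤⟨ +-mono-≤ (p δ) (q δ) ⟩
    c * M ^ d + c′ * M ^ d′                 ≤⟨ +-mono-≤ (*-monoʳ-≤ c (^-monoʳ-≤ M (m≤m+n d d′)))
                                                        (*-monoʳ-≤ c′ (^-monoʳ-≤ M (m≤n+m d′ d))) ⟩
    c * M ^ (d + d′) + c′ * M ^ (d + d′)    ≡⟨ *-distribʳ-+ (M ^ (d + d′)) c c′ ⟨
    (c + c′) * M ^ (d + d′)                 ∎
    where open ≤-Reasoning

  _*ₚ_ : ∀ {S T : D → ℕ} → Poly N S → Poly N T → Poly N (λ δ → S δ * T δ)
  _*ₚ_ {S} {T} (poly c d p) (poly c′ d′ q) = poly (c * c′) (d + d′) λ δ →
    let M = suc (N δ) in begin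
    S δ * T δ                     ≤⟨ *-mono-≤ (p δ) (q δ) ⟩
    c * M ^ d * (c′ * M ^ d′)     ≡⟨ [m*n]*[o*p]≡[m*o]*[n*p] c (M ^ d) c′ (M ^ d′) ⟩
    c * c′ * (M ^ d * M ^ d′)     ≡⟨ cong (c * c′ *_) (^-distribˡ-+-* M d d′) ⟨
    c * c′ * M ^ (d + d′)         ∎
    where open ≤-Reasoning

infixr 5 _⨾ₚ_

_⨾ₚ_ : ∀ {D : Set} {N S T : D → ℕ} → Poly N S → Poly N T → Poly N (λ δ → 1 + S δ + T δ)
P ⨾ₚ Q = const-poly 1 +ₚ P +ₚ Q

-- Terms: programs acting on the top of a stack

-- Variable 0, the only one used, holds a stack of trees.  A term replaces the
-- environment on top of the stack by its value and leaves the rest of the stack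
-- untouched, so that terms compose without any bookkeeping of variables.
record Term {D : Set} (N : D → ℕ) (env out : D → Tree) : Set where
  constructor term
  field
    code : Cmd
    time : D → ℕ
    poly-time : Poly N time
    runs : ∀ δ s → Runs code (env δ ∙ s) (time δ) (out δ ∙ s)

dup : Expr
dup = cons (hd X) X

module _ {D : Set} {N : D → ℕ} where

  private variable env mid out out′ : D → Tree

  conv : (∀ δ → out δ ≡ out′ δ) → Term N env out → Term N env out′
  conv {env = env} eq (term C T P r) = term C T P λ δ s →
    subst (λ y → Runs C (env δ ∙ s) (T δ) (y ∙ s)) (eq δ) (r δ s)

  reindex : ∀ {D′ : Set} (g : D′ → D) → Term N env out → Term (N ∘ g) (env ∘ g) (out ∘ g)
  reindex g (term C T (poly c d b) r) = term C (T ∘ g) (poly c d (b ∘ g)) (r ∘ g)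

  infixr 4 _▹_

  _▹_ : Term N env mid → Term N mid out → Term N env out
  term C T P r ▹ term C′ T′ P′ r′ =
    term (C ⨾ C′) _ (P ⨾ₚ P′) λ δ s → runs-seq (r δ s) (r′ δ s)

  onTop : Expr → Expr
  onTop (var _)    = hd X
  onTop (const t)  = const t
  onTop (cons e f) = cons (onTop e) (onTop f)
  onTop (hd e)     = hd (onTop e)
  onTop (tl e)     = tl (onTop e)

  app-onTop : ∀ e x s → app (onTop e) (x ∙ s) ≡ app e x
  app-onTop (var _)    x s = refl
  app-onTop (const _)  x s = refl
  app-onTop (cons e f) x s = cong₂ _∙_ (app-onTop e x s) (app-onTop f x s)
  app-onTop (hd e)     x s = cong head (app-onTop e x s)
  app-onTop (tl e)     x s = cong tail (app-onTop e x s)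

  by : ∀ e → Term N env (λ δ → app e (env δ))
  by {env} e = term (set e′) _ (set-poly e′) λ δ s →
    subst (λ y → Runs (set e′) (env δ ∙ s) (1 + cost (single e′)) (y ∙ s))
      (app-onTop e (env δ) s) (runs-set e′)
    where e′ = cons (onTop e) (tl X)

  -- A let-binding: the first program consumes the copy made by `dup`, and `merge` joins its value
  -- to the environment that was kept below.
  bind : Term N env mid → Term N (λ δ → mid δ ∙ env δ) out → Term N env out
  bind (term C T P r) (term C′ T′ P′ r′) =
    term (set dup ⨾ C ⨾ set merge ⨾ C′) _ (set-poly dup ⨾ₚ P ⨾ₚ set-poly merge ⨾ₚ P′)
      λ δ s → runs-seq (runs-set dup) (runs-seq (r δ _) (runs-seq (runs-set merge) (r′ δ s)))
    where
    merge = cons (cons (hd X) (hd (tl X))) (tl (tl X))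

  ifᵗ : ∀ {c x y : D → Tree} → Term N env c → Term N env x → Term N env y →
    Term N env (λ δ → if truth (c δ) then x δ else y δ)
  ifᵗ {env} {c} {x} {y} (term C T P r) (term C₁ T₁ P₁ r₁) (term C₂ T₂ P₂ r₂) =
    term (set dup ⨾ C ⨾ cond (hd X) (set (tl X) ⨾ C₁) (set (tl X) ⨾ C₂)) _
      -- The test costs 3; both branches are charged, so that the bound does not depend on the
      -- outcome.
      (set-poly dup ⨾ₚ P ⨾ₚ const-poly 3 +ₚ (set-poly (tl X) ⨾ₚ (P₁ +ₚ P₂)))
      λ δ s → runs-seq (runs-set dup) (runs-seq (r δ _) (runs-cond (hd X) _ refl (branch δ s (c δ))))
    where
    branch : ∀ δ s t → Runs (if truth t then set (tl X) ⨾ C₁ else (set (tl X) ⨾ C₂))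
      (t ∙ env δ ∙ s) (1 + (1 + 2) + (T₁ δ + T₂ δ)) ((if truth t then x δ else y δ) ∙ s)
    branch δ s nil     = runs-seq (runs-set (tl X)) (runs-≤ (m≤n+m _ _) (r₂ δ s))
    branch δ s (_ ∙ _) = runs-seq (runs-set (tl X)) (runs-≤ (m≤m+n _ _) (r₁ δ s))

-- Loops over lists

-- Between two iterations of a fold the stack is
-- accumulator ∙ remaining list ∙ environment ∙ rest.
next : Expr
next = cons (cons (hd (hd (tl X))) (cons (hd X) (hd (tl (tl X)))))
            (cons (tl (hd (tl X))) (tl (tl X)))

-- Since `B` bounds the body at every element and accumulator, the total is `length us` equal
-- iterations and one last, failing test.
runs-fold : ∀ {U A : Set} {C} {encU : U → Tree} {encA : A → Tree} {f : A → U → A} {env B} →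
  (∀ u a s → Runs C ((encU u ∙ encA a ∙ env) ∙ s) B (encA (f a u) ∙ s)) → ∀ us a s →
  Runs (while (hd (tl X)) (set next ⨾ C))
    (encA a ∙ encodeList (map encU us) ∙ env ∙ s)
    (length us * (1 + cost (hd (tl X)) + (1 + (1 + cost (single next)) + B)) + (1 + cost (hd (tl X))))
    (encA (foldl f a us) ∙ nil ∙ env ∙ s)
runs-fold r [] a s = runs-while-false (hd (tl X)) refl
runs-fold {B = B} r (u ∷ us) a s =
  runs-≤ (≤-reflexive (sym (+-assoc iteration (length us * iteration) _)))
    (runs-while-true (hd (tl X)) refl (runs-seq (runs-set next) (r u a _)) (runs-fold r us _ s))
  where iteration = 1 + cost (hd (tl X)) + (1 + (1 + cost (single next)) + B)

module _ {D : Set} {N : D → ℕ} {env : D → Tree} where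

  -- The index type of the body contains all elements and accumulators while its size stays `N δ`,
  -- so its bound is uniform over whatever accumulators arise.
  fold : ∀ {U A : D → Set} {encU : ∀ δ → U δ → Tree} {encA : ∀ δ → A δ → Tree}
    {us : ∀ δ → List (U δ)} {a : ∀ δ → A δ} {f : ∀ δ → A δ → U δ → A δ} →
    Poly N (λ δ → length (us δ)) →
    Term N env (λ δ → encodeList (map (encU δ) (us δ))) →
    Term N env (λ δ → encA δ (a δ)) →
    Term {Σ D λ δ → U δ × A δ} (λ (δ , _) → N δ)
      (λ (δ , u , a) → encU δ u ∙ encA δ a ∙ env δ) (λ (δ , u , a) → encA δ (f δ a u)) →
    Term N env (λ δ → encA δ (foldl (f δ) (a δ) (us δ)))
  fold L (term C T P r) (term C′ T′ P′ r′) (term C″ T″ (poly c d b) r″) =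
    term (set dup ⨾ C ⨾ set list ⨾ C′ ⨾ while (hd (tl X)) (set next ⨾ C″) ⨾ set result) _
      (set-poly dup ⨾ₚ P ⨾ₚ set-poly list ⨾ₚ P′ ⨾ₚ
        -- Each 4 is the cost of a loop test. The body enters through its bound `c * suc (N δ) ^ d`,
        -- which is the same in all iterations, rather than through `T″`.
        (L *ₚ (const-poly 4 +ₚ (set-poly next ⨾ₚ poly c d λ _ → ≤-refl)) +ₚ const-poly 4) ⨾ₚ
        set-poly result)
      λ δ s → runs-seq (runs-set dup) (runs-seq (r δ _) (runs-seq (runs-set list) (runs-seq (r′ δ _)
        (runs-seq (runs-fold (λ u a s → runs-≤ (b (δ , u , a)) (r″ (δ , u , a) s)) _ _ s)
          (runs-set result)))))
    where
    list   = cons (hd (tl X)) X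
    result = cons (hd X) (tl (tl (tl X)))

-- Encodings of numbers, vertices and matrices

truth-encodeBool : ∀ b → truth (encodeBool b) ≡ b
truth-encodeBool false = refl
truth-encodeBool true  = refl

unary : ℕ → Tree
unary n = encodeList (replicate n nil)

drop : ℕ → Tree → Tree
drop zero    t = t
drop (suc n) t = drop n (tail t)

foldl-tail : ∀ n t → foldl (λ t _ → tail t) t (replicate n nil) ≡ drop n t
foldl-tail zero    t = refl
foldl-tail (suc n) t = foldl-tail n (tail t)

head-drop-tabulate : ∀ {k} (f : Fin k → Tree) v → head (drop (toℕ v) (encodeList (tabulate f))) ≡ f v
head-drop-tabulate f zero    = refl
head-drop-tabulate f (suc v) = head-drop-tabulate (f ∘ suc) v

drop-nil : ∀ n → drop n nil ≡ nil
drop-nil zero    = refl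
drop-nil (suc n) = drop-nil n

truth-drop-unary : ∀ m n → truth (drop m (unary n)) ≡ (m <ᵇ n)
truth-drop-unary zero    zero    = refl
truth-drop-unary zero    (suc n) = refl
truth-drop-unary (suc m) zero    = cong truth (drop-nil m)
truth-drop-unary (suc m) (suc n) = truth-drop-unary m n

-- In decreasing order, so that consing along a left fold restores the
-- increasing order.
vertices : ∀ k → List (Fin k)
vertices k = reverse (allFin k)

unary-vertices : ∀ k → map unary (downFrom k) ≡ map (unary ∘ toℕ) (vertices k)
unary-vertices k = begin
  map unary (downFrom k)                      ≡⟨ cong (map unary) (reverse-upTo k) ⟨
  map unary (reverse (upTo k))                ≡⟨ cong (map unary ∘ reverse) (tabulate-toℕ k id) ⟨
  map unary (reverse (tabulate {n = k} toℕ))  ≡⟨ cong (map unary ∘ reverse) (map-tabulate {n = k} id toℕ) ⟨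
  map unary (reverse (map toℕ (allFin k)))    ≡⟨ cong (map unary) (reverse-map toℕ (allFin k)) ⟨
  map unary (map toℕ (vertices k))            ≡⟨ map-∘ (vertices k) ⟨
  map (unary ∘ toℕ) (vertices k)              ∎
  where
  open ≡-Reasoning
  tabulate-toℕ : ∀ k (f : ℕ → ℕ) → tabulate {n = k} (f ∘ toℕ) ≡ applyUpTo f k
  tabulate-toℕ zero    f = refl
  tabulate-toℕ (suc k) f = cong (f 0 ∷_) (tabulate-toℕ k (f ∘ suc))

foldl-suc : ∀ {U : Set} j (us : List U) → foldl (λ j _ → suc j) j us ≡ length us + j
foldl-suc j []       = refl
foldl-suc j (_ ∷ us) = trans (foldl-suc (suc j) us) (+-suc (length us) j)

length-allFin : ∀ k → length (allFin k) ≡ k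
length-allFin k = length-tabulate id

length-vertices : ∀ k → length (vertices k) ≡ k
length-vertices k = trans (length-reverse (allFin k)) (length-allFin k)

foldl-all : ∀ {U : Set} (p : U → Bool) b us → foldl (λ b u → b ∧ p u) b us ≡ b ∧ all p us
foldl-all p b []       = sym (∧-identityʳ b)
foldl-all p b (u ∷ us) = trans (foldl-all p (b ∧ p u) us) (∧-assoc b (p u) _)

foldl-any : ∀ {U : Set} (p : U → Bool) b us → foldl (λ b u → b ∨ p u) b us ≡ b ∨ any p us
foldl-any p b []       = sym (∨-identityʳ b)
foldl-any p b (u ∷ us) = trans (foldl-any p (b ∨ p u) us) (∨-assoc b (p u) _)

encodeVector : ∀ {k} → (Fin k → Bool) → Tree
encodeVector f = encodeList (tabulate (encodeBool ∘ f))

Matrix : ℕ → Set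
Matrix k = Fin k → Fin k → Bool

encodeMatrix : ∀ {k} → Matrix k → Tree
encodeMatrix f = encodeList (tabulate (encodeVector ∘ f))

encodeVertices : ℕ → Tree
encodeVertices k = encodeList (map (unary ∘ toℕ) (vertices k))

-- Terms for Booleans, quantifiers, tabulation and lookup

module _ {D : Set} {N : D → ℕ} {env : D → Tree} where

  ifᵇ : ∀ {b : D → Bool} {x y : D → Tree} →
    Term N env (encodeBool ∘ b) → Term N env x → Term N env y →
    Term N env (λ δ → if b δ then x δ else y δ)
  ifᵇ {b} {x} {y} c t e = conv (λ δ → cong (if_then x δ else y δ) (truth-encodeBool (b δ)))
    (ifᵗ c t e)

  constᵗ : ∀ t → Term N env (λ _ → t)
  constᵗ t = by (const t)

  notᵗ : ∀ {b : D → Bool} → Term N env (encodeBool ∘ b) → Term N env (encodeBool ∘ not ∘ b)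
  notᵗ {b} t = conv (λ δ → lemma (b δ)) (ifᵇ t (constᵗ (encodeBool false)) (constᵗ (encodeBool true)))
    where
    lemma : ∀ b → (if b then encodeBool false else encodeBool true) ≡ encodeBool (not b)
    lemma false = refl
    lemma true  = refl

  andᵗ : ∀ {a b : D → Bool} → Term N env (encodeBool ∘ a) → Term N env (encodeBool ∘ b) →
    Term N env (λ δ → encodeBool (a δ ∧ b δ))
  andᵗ {a} t u = conv (λ δ → lemma (a δ)) (ifᵇ t u (constᵗ (encodeBool false)))
    where
    lemma : ∀ a {b} → (if a then encodeBool b else encodeBool false) ≡ encodeBool (a ∧ b)
    lemma false = refl
    lemma true  = refl

  orᵗ : ∀ {a b : D → Bool} → Term N env (encodeBool ∘ a) → Term N env (encodeBool ∘ b) →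
    Term N env (λ δ → encodeBool (a δ ∨ b δ))
  orᵗ {a} t u = conv (λ δ → lemma (a δ)) (ifᵇ t (constᵗ (encodeBool true)) u)
    where
    lemma : ∀ a {b} → (if a then encodeBool true else encodeBool b) ≡ encodeBool (a ∨ b)
    lemma false = refl
    lemma true  = refl

  skip : ∀ {x out : D → Tree} → Term N env out → Term N (λ δ → x δ ∙ env δ) out
  skip t = by (tl X) ▹ t

  weaken : ∀ {U : D → Set} {out} {u : Σ D U → Tree} → Term N env out →
    Term (N ∘ proj₁) (λ ε → u ε ∙ env (proj₁ ε)) (out ∘ proj₁)
  weaken t = by (tl X) ▹ reindex proj₁ t

module _ {D : Set} {N : D → ℕ} {env : D → Tree} where

  module _ {U : D → Set} {encU : ∀ δ → U δ → Tree} {us : ∀ δ → List (U δ)}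
    (L : Poly N (λ δ → length (us δ)))
    (list : Term N env (λ δ → encodeList (map (encU δ) (us δ))))
    {p : ∀ δ → U δ → Bool}
    (t : Term {Σ D U} (N ∘ proj₁) (λ (δ , u) → encU δ u ∙ env δ) (λ (δ , u) → encodeBool (p δ u)))
    where

    private
      body : Term {Σ D λ δ → U δ × Bool} (N ∘ proj₁)
        (λ (δ , u , b) → encU δ u ∙ encodeBool b ∙ env δ) (λ (δ , u , b) → encodeBool (p δ u))
      body = by (cons (hd X) (tl (tl X))) ▹ reindex (λ (δ , u , _) → δ , u) t

      acc : Term {Σ D λ δ → U δ × Bool} (N ∘ proj₁)
        (λ (δ , u , b) → encU δ u ∙ encodeBool b ∙ env δ) (λ (δ , u , b) → encodeBool b)
      acc = by (hd (tl X))

    allᵗ : Term N env (λ δ → encodeBool (all (p δ) (us δ)))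
    allᵗ = conv (λ δ → cong encodeBool (foldl-all (p δ) true (us δ)))
      (fold {encA = λ _ → encodeBool} {f = λ δ b u → b ∧ p δ u} L list
        (constᵗ (encodeBool true)) (andᵗ acc body))

    anyᵗ : Term N env (λ δ → encodeBool (any (p δ) (us δ)))
    anyᵗ = conv (λ δ → cong encodeBool (foldl-any (p δ) false (us δ)))
      (fold {encA = λ _ → encodeBool} {f = λ δ b u → b ∨ p δ u} L list
        (constᵗ (encodeBool false)) (orᵗ acc body))

module _ {D : Set} {N : D → ℕ} where

  vertices-poly : Poly N (λ δ → length (vertices (N δ)))
  vertices-poly = poly-≤ (λ δ → ≤-reflexive (length-vertices (N δ))) size-poly

  allFin-poly : Poly N (λ δ → length (allFin (N δ)))
  allFin-poly = poly-≤ (λ δ → ≤-reflexive (length-allFin (N δ))) size-poly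

  vertex-poly : (v : ∀ δ → Fin (N δ)) → Poly N (λ δ → toℕ (v δ))
  vertex-poly v = poly-≤ (λ δ → <⇒≤ (toℕ<n (v δ))) size-poly

module _ {D : Set} {N : D → ℕ} {env : D → Tree} where

  -- The order is not given as a number and is found by counting rows. The accumulator pairs the
  -- counter with the list of all smaller numbers.
  verticesᵗ : {f : ∀ δ → Fin (N δ) → Tree} → Term N env (λ δ → encodeList (tabulate (f δ))) →
    Term N env (encodeVertices ∘ N)
  verticesᵗ {f} rows = conv (λ δ → cong encodeList (trans
        (cong (map unary ∘ downFrom) (trans (foldl-suc 0 (allFin (N δ)))
          (trans (+-identityʳ _) (length-allFin (N δ)))))
        (unary-vertices (N δ))))
      (fold {encU = f} {encA = λ _ j → unary j ∙ encodeList (map unary (downFrom j))}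
        {f = λ _ j _ → suc j}
        allFin-poly (conv (λ δ → cong encodeList (sym (map-tabulate id (f δ)))) rows)
        (constᵗ (nil ∙ nil))
        -- The old accumulator, read as a list, has `unary j` in front of the earlier numbers, so it
        -- is itself the new list.
        (by (cons (cons (const nil) (hd (hd (tl X)))) (hd (tl X))))
       ▹ by (tl X))

  tabulateᵗ : {f : ∀ δ → Fin (N δ) → Tree} → Term N env (encodeVertices ∘ N) →
    Term {Σ D (Fin ∘ N)} (N ∘ proj₁) (λ (δ , v) → unary (toℕ v) ∙ env δ) (λ (δ , v) → f δ v) →
    Term N env (λ δ → encodeList (tabulate (f δ)))
  tabulateᵗ {f} vs t = conv (λ δ → cong encodeList (trans
        (reverse-foldl (λ ts v → f δ v ∷ ts) [] (allFin (N δ)))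
        (trans (sym (map-is-foldr (allFin (N δ)))) (map-tabulate id (f δ)))))
      (fold {encA = λ _ → encodeList} {f = λ δ ts v → f δ v ∷ ts} vertices-poly vs (constᵗ nil)
        (bind (by (cons (hd X) (tl (tl X))) ▹ reindex (λ (δ , v , _) → δ , v) t)
          (by (cons (hd X) (hd (tl (tl X)))))))

  dropᵗ : {n : D → ℕ} {out : D → Tree} → Poly N n →
    Term N env (unary ∘ n) → Term N env out → Term N env (λ δ → drop (n δ) (out δ))
  dropᵗ {n} {out} P count t = conv (λ δ → foldl-tail (n δ) (out δ))
    (fold {encU = λ _ → id} {encA = λ _ → id} {us = λ δ → replicate (n δ) nil} {f = λ _ t _ → tail t}
      (poly-≤ (λ δ → ≤-reflexive (length-replicate (n δ))) P)
      (conv (λ δ → cong encodeList (sym (map-id _))) count) t (by (tl (hd (tl X)))))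

  lookupᵗ : {v : ∀ δ → Fin (N δ)} {f : ∀ δ → Fin (N δ) → Tree} →
    Term N env (λ δ → encodeList (tabulate (f δ))) → Term N env (λ δ → unary (toℕ (v δ))) →
    Term N env (λ δ → f δ (v δ))
  lookupᵗ {v} {f} t u = conv (λ δ → head-drop-tabulate (f δ) (v δ))
    (dropᵗ (vertex-poly v) u t ▹ by (hd X))

  <ᵗ : {u v : ∀ δ → Fin (N δ)} →
    Term N env (λ δ → unary (toℕ (u δ))) → Term N env (λ δ → unary (toℕ (v δ))) →
    Term N env (λ δ → encodeBool (toℕ (u δ) <ᵇ toℕ (v δ)))
  <ᵗ {u} {v} s t = conv (λ δ → trans (lemma _) (cong encodeBool (truth-drop-unary (toℕ (u δ)) (toℕ (v δ)))))
    (ifᵗ (dropᵗ (vertex-poly u) s t) (constᵗ (encodeBool true)) (constᵗ (encodeBool false)))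
    where
    lemma : ∀ b → (if b then encodeBool true else encodeBool false) ≡ encodeBool b
    lemma false = refl
    lemma true  = refl

-- Boolean matrices and their powers

-- Equality is the failure of both strict comparisons: trees have no equality primitive, whereas `<`
-- on unary numbers is tested by dropping nodes (`truth-drop-unary`).
identity : ∀ {k} → Matrix k
identity u v = not (toℕ u <ᵇ toℕ v) ∧ not (toℕ v <ᵇ toℕ u)

infixr 5 _∪ᵐ_

_∪ᵐ_ _·ᵐ_ : ∀ {k} → Matrix k → Matrix k → Matrix k
(Q ∪ᵐ R) u v = Q u v ∨ R u v
_·ᵐ_ {k} Q R u v = any (λ w → Q u w ∧ R w v) (vertices k)

power : ∀ {k} → Matrix k → ℕ → Matrix k
power Q zero    = identity
power Q (suc j) = Q ·ᵐ power Q j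

-- j, j − 1, …, 1 followed by rs; the choice of rs decides whether radius 0 is
-- allowed.
radii : List ℕ → ℕ → List ℕ
radii rs zero    = rs
radii rs (suc j) = suc j ∷ radii rs j

module _ {D : Set} {N : D → ℕ} {env : D → Tree} where

  matrixᵗ : {Q : ∀ δ → Matrix (N δ)} → Term N env (encodeVertices ∘ N) →
    Term {Σ (Σ D (Fin ∘ N)) (Fin ∘ N ∘ proj₁)} (N ∘ proj₁ ∘ proj₁)
      (λ ((δ , u) , v) → unary (toℕ v) ∙ unary (toℕ u) ∙ env δ) (λ ((δ , u) , v) → encodeBool (Q δ u v)) →
    Term N env (λ δ → encodeMatrix (Q δ))
  matrixᵗ vs t = tabulateᵗ vs (tabulateᵗ (weaken vs) t)

  entryᵗ : {Q : ∀ δ → Matrix (N δ)} {u v : ∀ δ → Fin (N δ)} → Term N env (λ δ → encodeMatrix (Q δ)) →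
    Term N env (λ δ → unary (toℕ (u δ))) → Term N env (λ δ → unary (toℕ (v δ))) →
    Term N env (λ δ → encodeBool (Q δ (u δ) (v δ)))
  entryᵗ {Q} {u} {v} q s t =
    lookupᵗ {v = v} {f = λ δ w → encodeBool (Q δ (u δ) w)}
      (lookupᵗ {v = u} {f = λ δ w → encodeVector (Q δ w)} q s) t

module _ {D : Set} {N : D → ℕ} {env : D → Tree} (vs : Term N env (encodeVertices ∘ N)) where

  identityᵗ : Term N env (λ δ → encodeMatrix {N δ} identity)
  identityᵗ = matrixᵗ vs (andᵗ
    (notᵗ (<ᵗ {u = λ ((_ , u) , _) → u} {v = λ (_ , v) → v} (by (hd (tl X))) (by (hd X))))
    (notᵗ (<ᵗ {u = λ (_ , v) → v} {v = λ ((_ , u) , _) → u} (by (hd X)) (by (hd (tl X))))))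

  module _ {Q R : ∀ δ → Matrix (N δ)} (q : Term N env (λ δ → encodeMatrix (Q δ)))
    (r : Term N env (λ δ → encodeMatrix (R δ))) where

    unionᵗ : Term N env (λ δ → encodeMatrix (Q δ ∪ᵐ R δ))
    unionᵗ = matrixᵗ vs (orᵗ
      (entryᵗ {Q = λ ((δ , _) , _) → Q δ} {u = λ ((_ , u) , _) → u} {v = λ (_ , v) → v}
        (weaken (weaken q)) (by (hd (tl X))) (by (hd X)))
      (entryᵗ {Q = λ ((δ , _) , _) → R δ} {u = λ ((_ , u) , _) → u} {v = λ (_ , v) → v}
        (weaken (weaken r)) (by (hd (tl X))) (by (hd X))))

    productᵗ : Term N env (λ δ → encodeMatrix (Q δ ·ᵐ R δ))
    productᵗ = matrixᵗ vs (anyᵗ vertices-poly (weaken (weaken vs)) (andᵗ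
      (entryᵗ {Q = λ (((δ , _) , _) , _) → Q δ} {u = λ (((_ , u) , _) , _) → u} {v = λ (_ , w) → w}
        (weaken (weaken (weaken q))) (by (hd (tl (tl X)))) (by (hd X)))
      (entryᵗ {Q = λ (((δ , _) , _) , _) → R δ} {u = λ (_ , w) → w} {v = λ ((_ , v) , _) → v}
        (weaken (weaken (weaken r))) (by (hd X)) (by (hd (tl X))))))

module _ {D : Set} {N : D → ℕ} {env : D → Tree} (vs : Term N env (encodeVertices ∘ N))
  {Q : ∀ δ → Matrix (N δ)} (q : Term N env (λ δ → encodeMatrix (Q δ))) where

  -- Keeping the latest power beside the list makes the next one a single product. The first
  -- component later yields the partite classes, the second the balls.
  powersᵗ : ∀ rs → Term N env (λ δ → encodeList (map (encodeMatrix ∘ power (Q δ)) rs)) →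
    Term N env (λ δ → encodeMatrix (power (Q δ) (N δ)) ∙
                      encodeList (map (encodeMatrix ∘ power (Q δ)) (radii rs (N δ))))
  powersᵗ rs start = conv (λ δ → cong (encodePowers δ) (trans (foldl-suc 0 (vertices (N δ)))
        (trans (+-identityʳ _) (length-vertices (N δ)))))
      (fold {encA = encodePowers} {f = λ _ j _ → suc j} vertices-poly vs
        (bind start (bind (skip (identityᵗ vs)) (by (cons (hd X) (hd (tl X))))))
        (bind (productᵗ (by (tl (tl X)) ▹ reindex proj₁ vs) (by (tl (tl X)) ▹ reindex proj₁ q)
                 (by (hd (hd (tl X)))))
          (by (cons (hd X) (cons (hd X) (tl (hd (tl (tl X)))))))))
    where
    encodePowers : ∀ δ → ℕ → Tree
    encodePowers δ j =
      encodeMatrix (power (Q δ) j) ∙ encodeList (map (encodeMatrix ∘ power (Q δ)) (radii rs j))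

-- The exhaustive test and its program

-- The continuation form turns a tuple into `n` pairs of nested loops, over radii and centres; for
-- fixed `n` this stays polynomial.
allVec : ∀ {U V : Set} → List U → List V → ∀ n → (Vec (U × V) n → Bool) → Bool
allVec us vs zero    p = p []
allVec us vs (suc n) p = all (λ u → all (λ v → allVec us vs n (λ xs → p ((u , v) ∷ xs))) vs) us

-- Subsets are never run-time data: `allSubsetsᵗ` writes out all 2^n cases in the code.
allSubsets : ∀ n → (Subset n → Bool) → Bool
allSubsets zero    p = p []
allSubsets (suc n) p = allSubsets n (λ S → p (true ∷ S)) ∧ allSubsets n (λ S → p (false ∷ S))

module _ {k : ℕ} (β : ℕ → Matrix k) where

  -- A ball is stored as its row, which is all that a membership test reads. Recursion on the length
  -- through `headᵛ` and `tailᵛ` lets the encoding unfold on a variable tuple.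
  encodeBalls : ∀ {n} → Vec (ℕ × Fin k) n → Tree
  encodeBalls {zero}  xs = nil
  encodeBalls {suc n} xs = encodeVector (β (proj₁ (headᵛ xs)) (proj₂ (headᵛ xs))) ∙ encodeBalls (tailᵛ xs)

  inBalls : ∀ {n} → (Fin k → Bool) → Subset n → Vec (ℕ × Fin k) n → Fin k → Bool
  inBalls W []          xs v = true
  inBalls W (true  ∷ S) xs v =
    (β (proj₁ (headᵛ xs)) (proj₂ (headᵛ xs)) v ∧ W v) ∧ inBalls W S (tailᵛ xs) v
  inBalls W (false ∷ S) xs v = inBalls W S (tailᵛ xs) v

  meets : ∀ {n} → (Fin k → Bool) → Subset n → Vec (ℕ × Fin k) n → Bool
  meets W S xs = any (inBalls W S xs) (vertices k)

  hellyFamily : ∀ {n} → ℕ → (Fin k → Bool) → Vec (ℕ × Fin k) n → Bool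
  hellyFamily {n} m W xs =
    not (allSubsets n λ S → not (∣ S ∣ ≡ᵇ m) ∨ meets W S xs) ∨ meets W ⊤ xs

  hellyCheck : ℕ → ℕ → List ℕ → Matrix k → Bool
  hellyCheck n m rs κ = all (λ w → allVec rs (allFin k) n (hellyFamily m (κ w))) (allFin k)

allVecᵗ : ∀ {D : Set} {N : D → ℕ} {rest : D → Tree} {β : ∀ δ → ℕ → Matrix (N δ)} {rs : D → List ℕ} n
  {p : ∀ δ → Vec (ℕ × Fin (N δ)) n → Bool} →
  Poly N (λ δ → length (rs δ)) →
  Term {Σ D λ δ → Vec (ℕ × Fin (N δ)) n} (N ∘ proj₁)
    (λ (δ , xs) → encodeBalls (β δ) xs ∙ encodeList (map (encodeMatrix ∘ β δ) (rs δ)) ∙ rest δ)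
    (λ (δ , xs) → encodeBool (p δ xs)) →
  Term N (λ δ → encodeList (map (encodeMatrix ∘ β δ) (rs δ)) ∙ rest δ)
    (λ δ → encodeBool (allVec (rs δ) (allFin (N δ)) n (p δ)))
allVecᵗ zero P t = by (cons (const nil) X) ▹ reindex (λ δ → δ , []) t
allVecᵗ {D} {N} {rest} {β} {rs} (suc n) {p} P@(poly c d b) t =
  allᵗ {encU = λ δ r → encodeMatrix (β δ r)} P (by (hd X))
    (allᵗ {encU = λ (δ , r) v → encodeVector (β δ r v)} allFin-poly
      (conv (λ (δ , r) → cong encodeList (sym (map-tabulate id (encodeVector ∘ β δ r)))) (by (hd X)))
      -- The chosen row is parked in front of `rest` while the other balls are chosen, and
      -- afterwards moved to the front of their encoding.
      (by (cons (hd (tl (tl X))) (cons (hd X) (tl (tl (tl X))))) ▹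
        allVecᵗ {β = λ ((δ , _) , _) → β δ} n (poly c d (b ∘ proj₁ ∘ proj₁))
          (by (cons (cons (hd (tl (tl X))) (hd X)) (cons (hd (tl X)) (tl (tl (tl X))))) ▹
            reindex (λ (((δ , r) , v) , xs) → δ , (r , v) ∷ xs) t)))

allSubsetsᵗ : ∀ {D : Set} {N : D → ℕ} {env : D → Tree} n {p : D → Subset n → Bool} →
  (∀ S → Term N env (λ δ → encodeBool (p δ S))) → Term N env (λ δ → encodeBool (allSubsets n (p δ)))
allSubsetsᵗ zero    t = t []
allSubsetsᵗ (suc n) t = andᵗ (allSubsetsᵗ n (t ∘ (true ∷_))) (allSubsetsᵗ n (t ∘ (false ∷_)))

inBallsᵗ : ∀ {D : Set} {N : D → ℕ} {β : ∀ δ → ℕ → Matrix (N δ)} {W : ∀ δ → Fin (N δ) → Bool}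
  {v : ∀ δ → Fin (N δ)} {n} (S : Subset n) →
  Term {Σ D λ δ → Vec (ℕ × Fin (N δ)) n} (N ∘ proj₁)
    (λ (δ , xs) → encodeBalls (β δ) xs ∙ unary (toℕ (v δ)) ∙ encodeVector (W δ))
    (λ (δ , xs) → encodeBool (inBalls (β δ) (W δ) S xs (v δ)))
inBallsᵗ [] = constᵗ _
inBallsᵗ {β = β} {W} {v} (true ∷ S) = andᵗ
  (andᵗ
    (lookupᵗ {v = v ∘ proj₁} {f = λ (δ , xs) u → encodeBool (β δ (proj₁ (headᵛ xs)) (proj₂ (headᵛ xs)) u)}
      (by (hd (hd X))) (by (hd (tl X))))
    (lookupᵗ {v = v ∘ proj₁} {f = λ (δ , _) u → encodeBool (W δ u)} (by (tl (tl X))) (by (hd (tl X)))))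
  (by (cons (tl (hd X)) (tl X)) ▹ reindex (λ (δ , xs) → δ , tailᵛ xs) (inBallsᵗ {β = β} {W} {v} S))
inBallsᵗ {β = β} {W} {v} (false ∷ S) =
  by (cons (tl (hd X)) (tl X)) ▹ reindex (λ (δ , xs) → δ , tailᵛ xs) (inBallsᵗ {β = β} {W} {v} S)

module _ {D : Set} {N : D → ℕ} {env : D → Tree} {β : ∀ δ → ℕ → Matrix (N δ)}
  (vs : Term N env (encodeVertices ∘ N)) where

  meetsᵗ : ∀ {n} {W : ∀ δ → Fin (N δ) → Bool} {xs : ∀ δ → Vec (ℕ × Fin (N δ)) n} →
    Term N env (λ δ → encodeVector (W δ)) → Term N env (λ δ → encodeBalls (β δ) (xs δ)) → ∀ S →
    Term N env (λ δ → encodeBool (meets (β δ) (W δ) S (xs δ)))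
  meetsᵗ {W = W} {xs} w t S = anyᵗ vertices-poly vs
    (bind (weaken w) (bind (skip (weaken t)) (by (cons (hd X) (cons (hd (tl (tl X))) (hd (tl X)))))) ▹
      reindex (λ (δ , v) → (δ , v) , xs δ) (inBallsᵗ {β = β ∘ proj₁} {W = W ∘ proj₁} {v = proj₂} S))

  hellyFamilyᵗ : ∀ {n} m {W : ∀ δ → Fin (N δ) → Bool} {xs : ∀ δ → Vec (ℕ × Fin (N δ)) n} →
    Term N env (λ δ → encodeVector (W δ)) → Term N env (λ δ → encodeBalls (β δ) (xs δ)) →
    Term N env (λ δ → encodeBool (hellyFamily (β δ) m (W δ) (xs δ)))
  hellyFamilyᵗ {n} m w t =
    orᵗ (notᵗ (allSubsetsᵗ n λ S → when (∣ S ∣ ≡ᵇ m) (meetsᵗ w t S))) (meetsᵗ w t ⊤)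
    where
    -- The size of `S` is known when the program is built, so a subset of the wrong size contributes
    -- only a constant.
    when : ∀ a {b : D → Bool} → Term N env (encodeBool ∘ b) → Term N env (λ δ → encodeBool (not a ∨ b δ))
    when true  t = t
    when false _ = constᵗ _

hellyCheckᵗ : ∀ {D : Set} {N : D → ℕ} {env : D → Tree} {β : ∀ δ → ℕ → Matrix (N δ)} {κ : ∀ δ → Matrix (N δ)}
  {rs : D → List ℕ} n m → Poly N (λ δ → length (rs δ)) → Term N env (encodeVertices ∘ N) →
  Term N env (λ δ → encodeList (map (encodeMatrix ∘ β δ) (rs δ))) → Term N env (λ δ → encodeMatrix (κ δ)) →
  Term N env (λ δ → encodeBool (hellyCheck (β δ) n m (rs δ) (κ δ)))
hellyCheckᵗ {β = β} {κ} n m (poly c d b) vs balls classes =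
  allᵗ {encU = λ δ w → encodeVector (κ δ w)} allFin-poly
    (conv (λ δ → cong encodeList (sym (map-tabulate id (encodeVector ∘ κ δ)))) classes)
    (bind (weaken balls) (allVecᵗ {β = β ∘ proj₁} n (poly c d (b ∘ proj₁))
      (hellyFamilyᵗ {β = β ∘ proj₁ ∘ proj₁} (by (tl (tl (tl X))) ▹ reindex (proj₁ ∘ proj₁) vs) m
        (by (hd (tl (tl X)))) (by (hd X)))))

-- Boolean tests and the propositions they decide

sound : ∀ {P : Set} {b} → Reflects P b → b ≡ true → P
sound (ofʸ p) refl = p

complete : ∀ {P : Set} {b} → Reflects P b → P → b ≡ true
complete (ofʸ _)  p = refl
complete (ofⁿ ¬p) p = contradiction p ¬p

reflects-map : ∀ {P Q : Set} {b} → (P → Q) → (Q → P) → Reflects P b → Reflects Q b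
reflects-map f g (ofʸ p)  = ofʸ (f p)
reflects-map f g (ofⁿ ¬p) = ofⁿ (¬p ∘ g)

true-reflects : ∀ b → Reflects (b ≡ true) b
true-reflects true  = ofʸ refl
true-reflects false = ofⁿ λ ()

module _ {U : Set} {P : U → Set} {p : U → Bool} (r : ∀ u → Reflects (P u) (p u)) where

  all-reflects : ∀ us → Reflects (∀ u → u ∈ us → P u) (all p us)
  all-reflects []       = ofʸ λ _ ()
  all-reflects (u ∷ us) = reflects-map
    (λ { (q , qs) _ (here refl) → q ; (q , qs) w (there w∈us) → qs w w∈us })
    (λ h → h u (here refl) , λ w → h w ∘ there)
    (r u ×-reflects all-reflects us)

  any-reflects : ∀ us → Reflects (∃[ u ] (u ∈ us × P u)) (any p us)
  any-reflects []       = ofⁿ λ ()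
  any-reflects (u ∷ us) = reflects-map
    (λ { (inj₁ q) → u , here refl , q ; (inj₂ (w , w∈us , q)) → w , there w∈us , q })
    (λ { (_ , here refl , q) → inj₁ q ; (w , there w∈us , q) → inj₂ (w , w∈us , q) })
    (r u ⊎-reflects any-reflects us)

any-vertices-reflects : ∀ {k} {P : Fin k → Set} {p} → (∀ v → Reflects (P v) (p v)) →
  Reflects (∃[ v ] P v) (any p (vertices k))
any-vertices-reflects {k} r = reflects-map
  (λ (v , _ , q) → v , q) (λ (v , q) → v , reverse⁺ (∈-allFin v) , q) (any-reflects r (vertices k))

module _ {k : ℕ} where

  identity-reflects : ∀ (u v : Fin k) → Reflects (u ≡ v) (identity u v)
  identity-reflects u v = reflects-map
    (λ (u≮v , v≮u) → toℕ-injective (≤-antisym (≮⇒≥ v≮u) (≮⇒≥ u≮v)))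
    (λ { refl → n≮n _ , n≮n _ })
    (¬-reflects (<ᵇ-reflects-< (toℕ u) (toℕ v)) ×-reflects ¬-reflects (<ᵇ-reflects-< (toℕ v) (toℕ u)))

  union-reflects : ∀ (Q R : Matrix k) u v → Reflects (Q u v ≡ true ⊎ R u v ≡ true) ((Q ∪ᵐ R) u v)
  union-reflects Q R u v = true-reflects (Q u v) ⊎-reflects true-reflects (R u v)

  product-reflects : ∀ (Q R : Matrix k) u v →
    Reflects (∃[ w ] (Q u w ≡ true × R w v ≡ true)) ((Q ·ᵐ R) u v)
  product-reflects Q R u v =
    any-vertices-reflects λ w → true-reflects (Q u w) ×-reflects true-reflects (R w v)

  identity-refl : ∀ u → identity {k} u u ≡ true
  identity-refl u = complete (identity-reflects u u) refl

-- Saturation of the powers of a reflexive matrix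

module Saturation {k : ℕ} (Q : Matrix k) (Q-refl : ∀ u → Q u u ≡ true) where

  power-suc : ∀ j {u v} → power Q j u v ≡ true → power Q (suc j) u v ≡ true
  power-suc j {u} {v} h = complete (product-reflects Q (power Q j) u v) (u , Q-refl u , h)

  power-mono : ∀ {i j} → i ≤ j → ∀ u v → power Q i u v ≡ true → power Q j u v ≡ true
  power-mono i≤j = go (≤⇒≤′ i≤j)
    where
    go : ∀ {i j} → i ≤′ j → ∀ u v → power Q i u v ≡ true → power Q j u v ≡ true
    go ≤′-refl             u v h = h
    go (≤′-step {n = j} p) u v h = power-suc j (go p u v h)

  module _ (v : Fin k) where

    -- The target is fixed rather than the source: `power` multiplies by `Q` on the left, so each
    -- set determines the next.
    reaching : ℕ → Subset k
    reaching j = Vec.tabulate λ u → power Q j u v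

    ∈-reaching⁺ : ∀ j {u} → power Q j u v ≡ true → u ∈ₛ reaching j
    ∈-reaching⁺ j {u} h = lookup⇒[]= u _ (trans (lookup∘tabulate _ u) h)

    ∈-reaching⁻ : ∀ j {u} → u ∈ₛ reaching j → power Q j u v ≡ true
    ∈-reaching⁻ j {u} u∈ = trans (sym (lookup∘tabulate _ u)) ([]=⇒lookup u∈)

    Stable : ℕ → Set
    Stable i = reaching (suc i) ⊆ reaching i

    stable-or-grows : ∀ i → Stable i ⊎ reaching i ⊂ reaching (suc i)
    stable-or-grows i with any? (λ u → (u ∈? reaching (suc i)) ×-dec ¬? (u ∈? reaching i))
    ... | yes new = inj₂ ((λ u∈ → ∈-reaching⁺ (suc i) (power-suc i (∈-reaching⁻ i u∈))) , new)
    ... | no ¬new = inj₁ λ {u} u∈ → decidable-stable (u ∈? reaching i) λ u∉ → ¬new (u , u∈ , u∉)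

    -- The sets of vertices that reach v grow strictly until they are stable.
    stable-or-large : ∀ j → (∃[ i ] (i < j × Stable i)) ⊎ j ≤ ∣ reaching j ∣
    stable-or-large zero = inj₂ z≤n
    stable-or-large (suc j) with stable-or-large j | stable-or-grows j
    ... | inj₁ (i , i<j , st) | _         = inj₁ (i , m<n⇒m<1+n i<j , st)
    ... | inj₂ _              | inj₁ st   = inj₁ (j , ≤-refl , st)
    ... | inj₂ large          | inj₂ grow = inj₂ (≤-<-trans large (p⊂q⇒∣p∣<∣q∣ grow))

    stabilises : ∃[ i ] (i ≤ k × Stable i)
    stabilises with stable-or-large (suc k)
    ... | inj₁ (i , i<1+k , st) = i , s≤s⁻¹ i<1+k , st
    -- `k + 1` rounds of strict growth would require more than `k` vertices.
    ... | inj₂ large            = contradiction (∣p∣≤n (reaching (suc k))) (<⇒≱ large)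

    -- By induction the tail of the product already lies in stage `i`; one further factor `Q` leads
    -- to stage `suc i`, and stability leads back.
    stable-absorbs : ∀ i → Stable i → ∀ j u → power Q j u v ≡ true → power Q i u v ≡ true
    stable-absorbs i st zero    u h = power-mono {0} {i} z≤n u v h
    stable-absorbs i st (suc j) u h with sound (product-reflects Q (power Q j) u v) h
    ... | w , Quw , h′ = ∈-reaching⁻ i (st (∈-reaching⁺ (suc i)
      (complete (product-reflects Q (power Q i) u v) (w , Quw , stable-absorbs i st j w h′))))

    power-saturates : ∀ j {u} → power Q j u v ≡ true → power Q k u v ≡ true
    power-saturates j {u} h with stabilises
    ... | i , i≤k , st = power-mono i≤k u v (stable-absorbs i st j u h)

-- Balls as rows of powers

module Distance (G : Graph) where
  open Graph G

  closed : Matrix order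
  closed = identity ∪ᵐ adj

  closed-refl : ∀ u → closed u u ≡ true
  closed-refl u = complete (union-reflects identity adj u u) (inj₁ (identity-refl u))

  open Saturation closed closed-refl public

  walk⇒power : ∀ {u v ℓ} → Walk adj u v ℓ → power closed ℓ u v ≡ true
  walk⇒power (stay {u}) = identity-refl u
  walk⇒power (step {u} {v} {w} {ℓ} a p) = complete (product-reflects closed (power closed ℓ) u w)
    (v , complete (union-reflects identity adj u v) (inj₂ a) , walk⇒power p)

  power⇒walk : ∀ j {u v} → power closed j u v ≡ true → ∃[ ℓ ] (ℓ ≤ j × Walk adj u v ℓ)
  power⇒walk zero {u} {v} h with refl ← sound (identity-reflects u v) h = 0 , z≤n , stay
  power⇒walk (suc j) {u} {v} h with sound (product-reflects closed (power closed j) u v) h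
  ... | w , c , h′ with power⇒walk j h′ | sound (union-reflects identity adj u w) c
  ... | ℓ , ℓ≤j , p | inj₂ a = suc ℓ , s≤s ℓ≤j , step a p
  ... | ℓ , ℓ≤j , p | inj₁ e with refl ← sound (identity-reflects u w) e = ℓ , m≤n⇒m≤1+n ℓ≤j , p

  -- `Ball` asks for the exact distance, which is the least exponent with a true entry. By
  -- monotonicity of the powers, a downward search may stop at the first false one.
  least-power : ∀ r {u v} → power closed r u v ≡ true →
    ∃[ d ] (d ≤ r × power closed d u v ≡ true × (∀ j → power closed j u v ≡ true → d ≤ j))
  least-power zero h = 0 , z≤n , h , λ _ _ → z≤n
  least-power (suc r) {u} {v} h with power closed r u v in eq
  ... | true with least-power r eq
  ...   | d , d≤r , h′ , least = d , m≤n⇒m≤1+n d≤r , h′ , least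
  least-power (suc r) {u} {v} h | false = suc r , ≤-refl , h , λ j h′ →
    ≰⇒> λ j≤r → case trans (sym (power-mono j≤r u v h′)) eq of λ ()

  power⇒ball : ∀ {r c v} → power closed r c v ≡ true → Ball c r v
  power⇒ball {r} h with least-power r h
  ... | d , d≤r , h′ , least with power⇒walk d h′
  -- A walk of length `ℓ` makes the `ℓ`-th power true, so leastness of `d` forces `ℓ` to equal `d`.
  ... | ℓ , ℓ≤d , p with refl ← ≤-antisym ℓ≤d (least ℓ (walk⇒power p)) =
    d , (p , λ j → least j ∘ walk⇒power) , d≤r

  ball⇒power : ∀ {r c v} → Ball c r v → power closed r c v ≡ true
  ball⇒power {c = c} {v} (d , (p , _) , d≤r) = power-mono d≤r c v (walk⇒power p)

  power-⊓ : ∀ r {c v} → power closed r c v ≡ true → power closed (r ⊓ order) c v ≡ true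
  power-⊓ r {c} {v} h with ⊓-sel r order
  ... | inj₁ eq rewrite eq = h
  ... | inj₂ eq rewrite eq = power-saturates v r h

-- Partite classes from walks of even length

module Parity (B : BipartiteGraph) where
  open BipartiteGraph B

  evenStep : Matrix order
  evenStep = identity ∪ᵐ adj ·ᵐ adj

  evenStep-refl : ∀ u → evenStep u u ≡ true
  evenStep-refl u = complete (union-reflects identity (adj ·ᵐ adj) u u) (inj₁ (identity-refl u))

  open Saturation evenStep evenStep-refl

  side-two-steps : ∀ {u v w} → adj u v ≡ true → adj v w ≡ true → side u ≡ side w
  side-two-steps {u} {v} {w} a b =
    trans (≢-side (proper u v a)) (sym (≢-side (proper v w b ∘ sym)))
    where
    ≢-side : ∀ {x y} → x ≢ y → x ≡ not y
    ≢-side {true}  {true}  ne = contradiction refl ne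
    ≢-side {true}  {false} ne = refl
    ≢-side {false} {true}  ne = refl
    ≢-side {false} {false} ne = contradiction refl ne

  power⇒side : ∀ j {u v} → power evenStep j u v ≡ true → side u ≡ side v
  power⇒side zero {u} {v} h = cong side (sound (identity-reflects u v) h)
  power⇒side (suc j) {u} {v} h with sound (product-reflects evenStep (power evenStep j) u v) h
  ... | w , s , h′ with sound (union-reflects identity (adj ·ᵐ adj) u w) s
  ... | inj₁ e = trans (cong side (sound (identity-reflects u w) e)) (power⇒side j h′)
  ... | inj₂ e with sound (product-reflects adj adj u w) e
  ... | x , a , b = trans (side-two-steps a b) (power⇒side j h′)

  -- The walk is consumed two edges at a time, which preserves the side of its start; a single edge
  -- left over would join equal sides, against `proper`.
  walk⇒even-power : ∀ {u v ℓ} → Walk adj u v ℓ → side u ≡ side v → ∃[ j ] power evenStep j u v ≡ true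
  walk⇒even-power (stay {u}) s = 0 , identity-refl u
  walk⇒even-power (step a stay) s = contradiction s (proper _ _ a)
  walk⇒even-power (step {u} {v} a (step {v = x} {w = w} b p)) s
    with walk⇒even-power p (trans (sym (side-two-steps a b)) s)
  ... | j , h = suc j , complete (product-reflects evenStep (power evenStep j) u w)
    (x , complete (union-reflects identity (adj ·ᵐ adj) u x)
      (inj₂ (complete (product-reflects adj adj u x) (v , a , b))) , h)

  side⇒power : ∀ {u v} → side u ≡ side v → power evenStep order u v ≡ true
  side⇒power {u} {v} s with walk⇒even-power (proj₂ (connected u v)) s
  ... | j , h = power-saturates v j h

-- Correctness of the exhaustive test

module _ {U V : Set} {us : List U} {vs : List V} where

  allVec-reflects : ∀ n {P : Vec (U × V) n → Set} {p} → (∀ xs → Reflects (P xs) (p xs)) →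
    Reflects (∀ xs → (∀ i → proj₁ (lookup xs i) ∈ us × proj₂ (lookup xs i) ∈ vs) → P xs) (allVec us vs n p)
  allVec-reflects zero    r = reflects-map (λ { q [] _ → q }) (λ h → h [] λ ()) (r [])
  allVec-reflects (suc n) r = reflects-map
    (λ { h ((u , v) ∷ xs) ∈s → h u (proj₁ (∈s zero)) v (proj₂ (∈s zero)) xs (∈s ∘ suc) })
    (λ h u u∈ v v∈ xs xs∈ → h ((u , v) ∷ xs) λ { zero → u∈ , v∈ ; (suc i) → xs∈ i })
    (all-reflects (λ u → all-reflects (λ v → allVec-reflects n λ xs → r ((u , v) ∷ xs)) vs) us)

allSubsets-reflects : ∀ n {P : Subset n → Set} {p} → (∀ S → Reflects (P S) (p S)) →
  Reflects (∀ S → P S) (allSubsets n p)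
allSubsets-reflects zero    r = reflects-map (λ { q [] → q }) (λ h → h []) (r [])
allSubsets-reflects (suc n) r = reflects-map
  (λ { (q , _) (true ∷ S) → q S ; (_ , q) (false ∷ S) → q S })
  (λ h → (λ S → h (true ∷ S)) , λ S → h (false ∷ S))
  (allSubsets-reflects n (r ∘ (true ∷_)) ×-reflects allSubsets-reflects n (r ∘ (false ∷_)))

helly-cong : ∀ {n m} {V : Set} {F G : Fin n → Pred V 0ℓ} →
  (∀ i v → F i v → G i v) → (∀ i v → G i v → F i v) → HellyFamily m F → HellyFamily m G
helly-cong f g h hyp with h (λ S eq → let w , q = hyp S eq in w , λ i i∈S → g i w (q i i∈S))
... | v , q = v , λ i → f i v (q i)

module _ {k : ℕ} (β : ℕ → Matrix k) where

  Trace : ∀ {n} → (Fin k → Bool) → Vec (ℕ × Fin k) n → Fin n → Pred (Fin k) 0ℓ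
  Trace W xs i v = β (proj₁ (lookup xs i)) (proj₂ (lookup xs i)) v ≡ true × W v ≡ true

  inBalls-reflects : ∀ {n} W (S : Subset n) xs v →
    Reflects (∀ i → i ∈ₛ S → Trace W xs i v) (inBalls β W S xs v)
  inBalls-reflects W []         xs             v = ofʸ λ _ ()
  inBalls-reflects W (true ∷ S) ((r , c) ∷ xs) v = reflects-map
    (λ { (q , _) zero _ → q ; (_ , q) (suc i) (there i∈S) → q i i∈S })
    (λ h → h zero here , λ i i∈S → h (suc i) (there i∈S))
    ((true-reflects (β r c v) ×-reflects true-reflects (W v)) ×-reflects inBalls-reflects W S xs v)
  inBalls-reflects W (false ∷ S) (_ ∷ xs) v = reflects-map
    (λ { q (suc i) (there i∈S) → q i i∈S }) (λ h i i∈S → h (suc i) (there i∈S))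
    (inBalls-reflects W S xs v)

  hellyFamily-reflects : ∀ {n} m W (xs : Vec (ℕ × Fin k) n) →
    Reflects (HellyFamily m (Trace W xs)) (hellyFamily β m W xs)
  hellyFamily-reflects m W xs =
    allSubsets-reflects _ (λ S →
      fromEquivalence (≡ᵇ⇒≡ ∣ S ∣ m) (≡⇒≡ᵇ ∣ S ∣ m) →-reflects meets-reflects S)
    →-reflects reflects-map (λ (v , q) → v , λ i → q i ∈⊤) (λ (v , q) → v , λ i _ → q i) (meets-reflects ⊤)
    where
    meets-reflects : ∀ S → Reflects (Satisfiable λ v → ∀ i → i ∈ₛ S → Trace W xs i v) (meets β W S xs)
    meets-reflects S = any-vertices-reflects (inBalls-reflects W S xs)

  hellyCheck-reflects : ∀ n m rs κ →
    Reflects (∀ w (xs : Vec (ℕ × Fin k) n) → (∀ i → proj₁ (lookup xs i) ∈ rs) → HellyFamily m (Trace (κ w) xs))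
      (hellyCheck β n m rs κ)
  hellyCheck-reflects n m rs κ = reflects-map
    (λ h w xs ∈rs → h w (∈-allFin w) xs λ i → ∈rs i , ∈-allFin _)
    (λ h w _ xs ∈s → h w xs (proj₁ ∘ ∈s))
    (all-reflects (λ w → allVec-reflects n (hellyFamily-reflects m (κ w))) (allFin k))

∈-radii : ∀ {r} rs j → 1 ≤ r → r ≤ j → r ∈ radii rs j
∈-radii rs zero    (s≤s _) ()
∈-radii rs (suc j) 1≤r r≤1+j with m≤n⇒m<n∨m≡n r≤1+j
... | inj₁ r<1+j = there (∈-radii rs j 1≤r (s≤s⁻¹ r<1+j))
... | inj₂ refl  = here refl

zero-∈-radii : ∀ j → 0 ∈ radii (0 ∷ []) j
zero-∈-radii zero    = here refl
zero-∈-radii (suc j) = there (zero-∈-radii j)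

radii-positive : ∀ {r} j → r ∈ radii [] j → 1 ≤ r
radii-positive (suc j) (here refl) = s≤s z≤n
radii-positive (suc j) (there r∈)  = radii-positive j r∈

module _ (G : Graph) (n m : ℕ) (κ : Matrix (Graph.order G)) where
  open Graph G
  open Distance G

  module _ {s rs} (capped∈ : ∀ r → s ≤ r → r ⊓ order ∈ radii rs order)
    (∈⇒≥ : ∀ r → r ∈ radii rs order → s ≤ r) where

    private
      Checked Intended : Set
      Checked = ∀ w (xs : Vec (ℕ × Vertex) n) → (∀ i → proj₁ (lookup xs i) ∈ radii rs order) →
        HellyFamily m (Trace (power closed) (κ w) xs)
      Intended = ∀ w (c : Fin n → Vertex) (r : Fin n → ℕ) → (∀ i → s ≤ r i) →
        HellyFamily m λ i v → Ball (c i) (r i) v × κ w v ≡ true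

      checked⇒intended : Checked → Intended
      checked⇒intended h w c r s≤r = helly-cong
        (λ i v (q , q′) → power⇒ball (power-mono (m⊓n≤m (r i) order) (c i) v (trans (sym (same i v)) q)) , q′)
        (λ i v (q , q′) → trans (same i v) (power-⊓ (r i) (ball⇒power q)) , q′)
        (h w xs λ i → subst (_∈ radii rs order) (sym (cong proj₁ (lookup∘tabulate capped i)))
          (capped∈ (r i) (s≤r i)))
        where
        capped : Fin n → ℕ × Vertex
        capped i = r i ⊓ order , c i
        xs = Vec.tabulate capped
        same : ∀ i v → power closed (proj₁ (lookup xs i)) (proj₂ (lookup xs i)) v ≡
                       power closed (r i ⊓ order) (c i) v
        same i v = cong (λ (r , c) → power closed r c v) (lookup∘tabulate capped i)

      intended⇒checked : Intended → Checked
      intended⇒checked h w xs ∈rs = helly-cong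
        (λ i v (q , q′) → ball⇒power q , q′) (λ i v (q , q′) → power⇒ball q , q′)
        (h w (proj₂ ∘ lookup xs) (proj₁ ∘ lookup xs) λ i → ∈⇒≥ _ (∈rs i))

    -- Here `s` is the least admissible radius: 1 for the Helly property, 0 for its bipartite form.
    -- Capping a radius at `order` leaves the ball unchanged, by `power-⊓` and `power-mono`.
    ballCheck-reflects : Reflects Intended (hellyCheck (power closed) n m (radii rs order) κ)
    ballCheck-reflects = reflects-map checked⇒intended intended⇒checked
      (hellyCheck-reflects (power closed) n m (radii rs order) κ)

everything : ∀ {k} → Matrix k
everything _ _ = true

helly-reflects : ∀ n m G → let open Graph G; open Distance G in
  Reflects (Helly (suc n) m G) (hellyCheck (power closed) (suc n) m (radii [] order) everything)
helly-reflects n m G = reflects-map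
  -- All rows of `everything` are full, so any vertex may select the row; `c zero` exists because
  -- the family has `suc n` members.
  (λ h c r 1≤r → helly-cong (λ _ _ → proj₁) (λ _ _ q → q , refl) (h (c zero) c r 1≤r))
  (λ h w c r 1≤r → helly-cong (λ _ _ q → q , refl) (λ _ _ → proj₁) (h c r 1≤r))
  (ballCheck-reflects G (suc n) m everything
    -- As `order` is positive, capping never turns a positive radius into 0.
    (λ r 1≤r → ∈-radii [] order (⊓-glb 1≤r (>-nonZero⁻¹ order {{nonempty}})) (m⊓n≤n r order))
    (λ r → radii-positive order))
  where open Graph G

-- Together with index `zero` it gives a set of `suc m` indices, to which the Helly hypothesis is
-- applied to find a vertex of the class.
subset-of-size : ∀ {n m} → m ≤ n → ∃[ S ] ∣_∣ {n} S ≡ m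
subset-of-size {n}     z≤n       = ⊥ , ∣⊥∣≡0 n
subset-of-size {suc n} (s≤s m≤n) = let S , eq = subset-of-size m≤n in true ∷ S , cong suc eq

bipartiteHelly-reflects : ∀ n m → m ≤ n → ∀ B →
  let open BipartiteGraph B; open Distance graph; open Parity B in
  Reflects (BipartiteHelly (suc n) (suc m) B)
    (hellyCheck (power closed) (suc n) (suc m) (radii (0 ∷ []) order) (power evenStep order))
bipartiteHelly-reflects n m m≤n B = reflects-map
  -- A class b meeting the hypothesis is inhabited, hence the class of some vertex.
  (λ h c r b hyp →
    let S , eq  = subset-of-size m≤n
        w , q   = hyp (true ∷ S) (cong suc eq)
        w∈b     = proj₂ (q zero here)
    in helly-cong
      (λ i v (q , q′) → q , trans (sym (power⇒side order q′)) w∈b)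
      (λ i v (q , v∈b) → q , side⇒power (trans w∈b (sym v∈b)))
      (h w c r λ _ → z≤n) hyp)
  (λ h w c r _ → helly-cong
    (λ i v (q , v∈b) → q , side⇒power (sym v∈b))
    (λ i v (q , q′) → q , sym (power⇒side order q′))
    (h c r (side w)))
  (ballCheck-reflects graph (suc n) (suc m) (power evenStep order)
    (λ { zero _ → zero-∈-radii order
       ; r@(suc _) _ → ∈-radii (0 ∷ []) order
           (⊓-glb (s≤s z≤n) (>-nonZero⁻¹ order {{nonempty}})) (m⊓n≤n r order) })
    (λ _ _ → z≤n))
  where
  open BipartiteGraph B
  open Parity B

-- Bounds in |H| and assembly of the algorithms

-- From N + 1 ≤ 2N for positive N. This trades the base `suc N` of `Poly` for the base |H| of
-- `PolyTimeDecidable`, at the price of the factor 2^d.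
suc-^-≤ : ∀ N .{{_ : NonZero N}} d → suc N ^ d ≤ 2 ^ d * N ^ d
suc-^-≤ N zero    = ≤-refl
suc-^-≤ N (suc d) = begin
  suc N * suc N ^ d           ≤⟨ *-mono-≤ (+-monoˡ-≤ N (>-nonZero⁻¹ N)) (suc-^-≤ N d) ⟩
  (N + N) * (2 ^ d * N ^ d)   ≡⟨ cong (λ M → (N + M) * (2 ^ d * N ^ d)) (+-identityʳ N) ⟨
  2 * N * (2 ^ d * N ^ d)     ≡⟨ [m*n]*[o*p]≡[m*o]*[n*p] 2 N (2 ^ d) (N ^ d) ⟩
  2 ^ suc d * N ^ suc d       ∎
  where open ≤-Reasoning

module _ {A : Set} (g : A → Graph) where

  private
    N : A → ℕ
    N = Graph.order ∘ g

    input : A → Tree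
    input = encodeGraph ∘ g

  term⇒decidable : ∀ {P : A → Set} {b : A → Bool} → (∀ a → Reflects (P a) (b a)) →
    Term N input (λ a → encodeBool (b a)) → PolyTimeDecidable g P
  term⇒decidable {b = b} reflects (term C T P r)
    with set-poly {N = N} (cons X (const nil)) ⨾ₚ P ⨾ₚ set-poly (hd X)
  -- The input is made into a stack with a single entry, and at the end the answer is taken off the
  -- top.
  ... | poly c d bound = (read 0 body set (cons X (const nil)) ⨾ C ⨾ set (hd X) write 0) ,
    c * 2 ^ d , d , λ a →
      let instance _ = Graph.nonempty (g a)
          σ , t , exec , t≤ , eq =
            runs-seq (runs-set (cons X (const nil))) (runs-seq (r a nil) (runs-set (hd X)))
              ((λ _ → nil) [ 0 ↦ input a ]) refl
      in b a , t , (σ , exec , eq) ,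
         ≤-trans t≤ (≤-trans (bound a) (≤-trans (*-monoʳ-≤ c (suc-^-≤ (N a) d))
           (≤-reflexive (sym (*-assoc c (2 ^ d) (N a ^ d)))))) ,
         reflects a

  private
    adjᵗ : Term N input (λ a → encodeMatrix (Graph.adj (g a)))
    adjᵗ = by X

    vsᵗ : Term N input (encodeVertices ∘ N)
    vsᵗ = verticesᵗ adjᵗ

  closedᵗ : Term N input (λ a → encodeMatrix (Distance.closed (g a)))
  closedᵗ = unionᵗ vsᵗ (identityᵗ vsᵗ) adjᵗ

  evenPowerᵗ : Term N input (λ a → encodeMatrix
    (power (identity ∪ᵐ Graph.adj (g a) ·ᵐ Graph.adj (g a)) (N a)))
  evenPowerᵗ = powersᵗ vsᵗ (unionᵗ vsᵗ (identityᵗ vsᵗ) (productᵗ vsᵗ adjᵗ adjᵗ)) [] (constᵗ nil) ▹ by (hd X)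

  everythingᵗ : Term N input (λ a → encodeMatrix {N a} everything)
  everythingᵗ = matrixᵗ vsᵗ (constᵗ _)

  radii-poly : ∀ rs → Poly N (λ a → length (radii rs (N a)))
  radii-poly rs = poly-≤ (λ a → ≤-reflexive (length-radii (N a))) (size-poly +ₚ const-poly (length rs))
    where
    length-radii : ∀ j → length (radii rs j) ≡ j + length rs
    length-radii zero    = refl
    length-radii (suc j) = cong suc (length-radii j)

  ballCheckᵗ : ∀ {κ : ∀ a → Matrix (N a)} n m rs →
    Term N input (λ a → encodeList (map (encodeMatrix ∘ power (Distance.closed (g a))) rs)) →
    Term N input (λ a → encodeMatrix (κ a)) →
    Term N input (λ a → encodeBool (hellyCheck (power (Distance.closed (g a))) n m (radii rs (N a)) (κ a)))
  ballCheckᵗ n m rs start = hellyCheckᵗ n m (radii-poly rs) vsᵗ (powersᵗ vsᵗ closedᵗ rs start ▹ by (tl X))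

  radiusZeroᵗ : Term N input (λ a → encodeList (map (encodeMatrix ∘ power (Distance.closed (g a))) (0 ∷ [])))
  radiusZeroᵗ = identityᵗ vsᵗ ▹ by (cons X (const nil))

proposition5p1 : ∀ (n m : ℕ) → 1 ≤ m → m < n →
    PolyTimeDecidable id (Helly n m)
    × PolyTimeDecidable BipartiteGraph.graph (BipartiteHelly n m)
proposition5p1 (suc n) (suc m) (s≤s z≤n) (s≤s m<n) =
  term⇒decidable id (helly-reflects n (suc m))
    (ballCheckᵗ id (suc n) (suc m) [] (constᵗ nil) (everythingᵗ id)) ,
  term⇒decidable graph (bipartiteHelly-reflects n m (<⇒≤ m<n))
    (ballCheckᵗ graph (suc n) (suc m) (0 ∷ []) (radiusZeroᵗ graph) (evenPowerᵗ graph))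
  where open BipartiteGraph using (graph)
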